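{- Let $G_p$ be a Gaussian Mersenne prime. If $G_p=x^2+7y^2$ with $x,y\in\mathbb{Z}$, then $x\equiv\pm1\pmod 8$ and $4\mid y$.
   Context: For a rational prime $p$, the Gaussian Mersenne number is $\mu_p=(1\pm i)^p-1\in\mathbb{Z}[i]$, and $G_p=N(\mu_p)$ is its norm; for odd $p$ one has $G_p=2^{p}-\left(\frac{2}{p}\right)2^{\frac{p+1}{2}}+1$, where $\left(\frac{2}{p}\right)$ is the Legendre symbol. If $G_p$ is a rational prime it is called a Gaussian Mersenne prime. -}

module Defs where

open import Level using (0ℓ)
open import Algebra.Bundles.Raw using (RawRing)
open import Data.Nat.Base using (ℕ)
open import Data.Nat.Primality using (Prime)
open import Data.Integer.Base using (ℤ; +_; 0ℤ; 1ℤ; _+_; _-_; _*_; -_; _^_; ∣_∣; _◃_)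
open import Data.Integer.Divisibility.Signed using (_∣_)
open import Data.Product.Base using (_×_)
open import Data.Sign.Base using (Sign)
open import Relation.Binary.PropositionalEquality.Core using (_≡_)
import Algebra.Definitions.RawSemiring as RawSemiringDefs

infix 7 _+_i

record ℤ[i] : Set where
  constructor _+_i
  field
    re : ℤ
    im : ℤ

open ℤ[i] public

ℤ[i]-rawRing : RawRing 0ℓ 0ℓ
ℤ[i]-rawRing = record
  { Carrier = ℤ[i]
  ; _≈_     = _≡_
  ; _+_     = λ z w → (re z + re w) + (im z + im w) i
  ; _*_     = λ z w → (re z * re w - im z * im w) + (re z * im w + im z * re w) i
  ; -_      = λ z → (- re z) + (- im z) i
  ; 0#      = 0ℤ + 0ℤ i
  ; 1#      = 1ℤ + 0ℤ i
  }

module 𝔾 where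
  open RawRing ℤ[i]-rawRing public
  open RawSemiringDefs rawSemiring public using (_^_)

norm : ℤ[i] → ℤ
norm z = re z ^ 2 + im z ^ 2

-- 1 + i for Sign.+ and 1 - i for Sign.-
1±i : Sign → ℤ[i]
1±i s = 1ℤ + (s ◃ 1) i

μ : Sign → ℕ → ℤ[i]
μ s p = (1±i s 𝔾.^ p) 𝔾.+ (𝔾.- 𝔾.1#)

-- The two choices of sign give conjugate values of μ, hence the same norm;
-- the sign is kept as a parameter so that neither choice is privileged.
G : Sign → ℕ → ℤ
G s p = norm (μ s p)

-- Prime is the primality predicate on ℕ; as a norm, G s p is nonnegative, so
-- ∣ G s p ∣ is the same number.
GaussianMersennePrime : Sign → ℕ → Set
GaussianMersennePrime s p = Prime p × Prime ∣ G s p ∣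

infix 4 _≡_[mod_]

_≡_[mod_] : ℤ → ℤ → ℤ → Set
a ≡ b [mod m ] = m ∣ a - b

{-# OPTIONS --safe #-}

-- Since (1 ± i)⁶ = ∓8i, for p ≥ 6 we get μ = 8w - 1 with w ∈ ℤ[i], hence
-- G ≡ 1 (mod 16), and the claim is a finite check on the residues of x and y
-- mod 16. For p = 2, 3, 5 the values 5, 13, 41 of G are non-squares mod 7, so
-- they are not of the form x² + 7y².
module Submission where

open import Defs
open import Data.Nat.Base as ℕ using (ℕ; suc; NonZero)
open import Data.Nat.Primality using (prime?)
open import Data.Integer.Base using (ℤ; +_; 1ℤ; -1ℤ; _+_; _-_; _*_; -_; _^_)
open import Data.Integer.DivMod using (_/ℕ_; _%ℕ_; a≡a%ℕn+[a/ℕn]*n; n%ℕd<d)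
open import Data.Integer.Divisibility.Signed
  using (_∣_; divides; _∣?_; ∣-trans; ∣m∣n⇒∣m+n; ∣m⇒∣m*n)
open import Data.Integer.Properties using (*-identityˡ)
open import Data.Integer.Tactic.RingSolver using (solve-∀)
open import Data.Fin.Base using (Fin; toℕ; fromℕ<)
open import Data.Fin.Properties using (all?; toℕ-fromℕ<)
open import Data.Product.Base using (_×_; _,_; ∃-syntax; map)
open import Data.Sign.Base as Sign using (Sign)
open import Data.Sum.Base as Sum using (_⊎_)
open import Relation.Nullary.Decidable
  using (Dec; from-yes; from-no; _→-dec_; _⊎-dec_; _×-dec_; ¬?)
open import Relation.Nullary.Negation using (¬_; contradiction)
open import Relation.Binary.PropositionalEquality
  using (_≡_; _≢_; refl; cong; cong₂; subst; module ≡-Reasoning)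

-- The representative lies in `Fin n`, so statements about residues become finite searches that
-- `all?` can decide.
residue : ∀ n .{{_ : NonZero n}} (x : ℤ) → ∃[ r ] x ≡ + toℕ {n} r [mod + n ]
residue n x = fromℕ< r<n , divides (x /ℕ n) (begin
  x - + toℕ (fromℕ< r<n)                     ≡⟨ cong (λ k → x - + k) (toℕ-fromℕ< r<n) ⟩
  x - + r                                    ≡⟨ cong (_- + r) (a≡a%ℕn+[a/ℕn]*n x n) ⟩
  (+ r + x /ℕ n * + n) - + r                 ≡⟨ cancel (+ r) (x /ℕ n * + n) ⟩
  x /ℕ n * + n                               ∎)
  where
  open ≡-Reasoning
  r = x %ℕ n
  r<n = n%ℕd<d x n
  cancel : ∀ a b → (a + b) - a ≡ b
  cancel = solve-∀

mod-sym : ∀ {m} a b → a ≡ b [mod m ] → b ≡ a [mod m ]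
mod-sym {m} a b (divides q eq) = divides (- q) (begin
  b - a     ≡⟨ flip a b ⟩
  - (a - b) ≡⟨ cong -_ eq ⟩
  - (q * m) ≡⟨ neg q m ⟩
  - q * m   ∎)
  where
  open ≡-Reasoning
  flip : ∀ a b → b - a ≡ - (a - b)
  flip = solve-∀
  neg : ∀ q m → - (q * m) ≡ - q * m
  neg = solve-∀

mod-trans : ∀ {m} a b c → a ≡ b [mod m ] → b ≡ c [mod m ] → a ≡ c [mod m ]
mod-trans {m} a b c p q = subst (m ∣_) (telescope a b c) (∣m∣n⇒∣m+n p q)
  where
  telescope : ∀ a b c → (a - b) + (b - c) ≡ a - c
  telescope = solve-∀

∣-trans-mod : ∀ {m} a b → a ≡ b [mod m ] → m ∣ b → m ∣ a
∣-trans-mod {m} a b p q = subst (m ∣_) (telescope a b) (∣m∣n⇒∣m+n p q)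
  where
  telescope : ∀ a b → (a - b) + b ≡ a
  telescope = solve-∀

form : ℤ → ℤ → ℤ
form x y = x ^ 2 + + 7 * y ^ 2

form-cong : ∀ {m} x r y s → x ≡ r [mod m ] → y ≡ s [mod m ] →
  form x y ≡ form r s [mod m ]
form-cong {m} x r y s p q = subst (m ∣_) (difference x r y s)
  -- Both differences of squares factor: `x - r` divides the first and `y - s` the second.
  (∣m∣n⇒∣m+n (∣m⇒∣m*n (x + r) p) (∣m⇒∣m*n (+ 7 * (y + s)) q))
  where
  difference : ∀ x r y s → (x - r) * (x + r) + (y - s) * (+ 7 * (y + s)) ≡
    (x * (x * 1ℤ) + + 7 * (y * (y * 1ℤ))) - (r * (r * 1ℤ) + + 7 * (s * (s * 1ℤ)))
  difference = solve-∀

-- Decided over 256 pairs. By hand: mod 16 odd squares are 1 or 9 and even ones 0 or 4, so the value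
-- 1 forces `r` odd, `4 ∣ s` and `r` squared to be 1; the residues ±3 mod 8 have square 9. Modulus 8
-- would not separate these.
form-residues-mod-16 : ∀ (r s : Fin 16) →
  form (+ toℕ r) (+ toℕ s) ≡ 1ℤ [mod + 16 ] →
  (+ toℕ r ≡ 1ℤ [mod + 8 ] ⊎ + toℕ r ≡ -1ℤ [mod + 8 ]) × + 4 ∣ + toℕ s
form-residues-mod-16 = from-yes (all? {n = 16} λ r → all? {n = 16} λ s →
  (+ 16 ∣? form (+ toℕ r) (+ toℕ s) - 1ℤ) →-dec
  (((+ 8 ∣? + toℕ r - 1ℤ) ⊎-dec (+ 8 ∣? + toℕ r - -1ℤ)) ×-dec (+ 4 ∣? + toℕ s)))

form≡1[mod16] : ∀ x y → form x y ≡ 1ℤ [mod + 16 ] →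
  (x ≡ 1ℤ [mod + 8 ] ⊎ x ≡ -1ℤ [mod + 8 ]) × + 4 ∣ y
form≡1[mod16] x y f≡1 with residue 16 x | residue 16 y
... | r , x≡r | s , y≡s =
  map (Sum.map (mod-trans x r′ 1ℤ x≡r[8]) (mod-trans x r′ -1ℤ x≡r[8])) (∣-trans-mod y s′ y≡s[4])
    (form-residues-mod-16 r s (mod-trans (form r′ s′) (form x y) 1ℤ
      (mod-sym (form x y) (form r′ s′) (form-cong x r′ y s′ x≡r y≡s)) f≡1))
  where
  r′ = + toℕ r
  s′ = + toℕ s
  -- 8 and 4 divide 16, so the conclusions pass from the residues back to `x` and `y`.
  x≡r[8] : x ≡ r′ [mod + 8 ]
  x≡r[8] = ∣-trans (divides (+ 2) refl) x≡r
  y≡s[4] : y ≡ s′ [mod + 4 ]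
  y≡s[4] = ∣-trans (divides (+ 4) refl) y≡s

-- Modulo 7 the form is just the square of its first argument, so this says that `g` is a quadratic
-- non-residue.
NonRepresentableMod7 : ℤ → Set
NonRepresentableMod7 g = ∀ (r s : Fin 7) → ¬ form (+ toℕ r) (+ toℕ s) ≡ g [mod + 7 ]

nonRepresentableMod7? : ∀ g → Dec (NonRepresentableMod7 g)
nonRepresentableMod7? g = all? λ r → all? λ s →
  ¬? (+ 7 ∣? form (+ toℕ r) (+ toℕ s) - g)

nonRepresentableMod7⇒≢form : ∀ {g} → NonRepresentableMod7 g → ∀ x y → g ≢ form x y
nonRepresentableMod7⇒≢form nonrep x y refl with residue 7 x | residue 7 y
... | r , x≡r | s , y≡s = nonrep r s
  (mod-sym (form x y) (form (+ toℕ r) (+ toℕ s))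
    (form-cong x (+ toℕ r) y (+ toℕ s) x≡r y≡s))

infixr 7 _·_

_·_ : ℤ → ℤ[i] → ℤ[i]
m · z = (m * re z) + (m * im z) i

-- Multiplication by (1 ± i)² / 2 = ± i.
rotate : Sign → ℤ[i] → ℤ[i]
rotate Sign.+ z = (- im z) + re z i
rotate Sign.- z = im z + (- re z) i

-- Since (1 ± i)² = ±2i, two multiplications double the scalar. Keeping `m` explicit lets the powers
-- of 2 accumulate outside the Gaussian integer.
square-step : ∀ s m z → 1±i s 𝔾.* (1±i s 𝔾.* (m · z)) ≡ (+ 2 * m) · rotate s z
square-step Sign.+ m (a + b i) = cong₂ _+_i (re≡ m a b) (im≡ m a b)
  where
  re≡ : ∀ m a b → 1ℤ * (1ℤ * (m * a) - 1ℤ * (m * b)) - 1ℤ * (1ℤ * (m * b) + 1ℤ * (m * a))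
      ≡ (+ 2 * m) * (- b)
  re≡ = solve-∀
  im≡ : ∀ m a b → 1ℤ * (1ℤ * (m * b) + 1ℤ * (m * a)) + 1ℤ * (1ℤ * (m * a) - 1ℤ * (m * b))
      ≡ (+ 2 * m) * a
  im≡ = solve-∀
square-step Sign.- m (a + b i) = cong₂ _+_i (re≡ m a b) (im≡ m a b)
  where
  re≡ : ∀ m a b → 1ℤ * (1ℤ * (m * a) - -1ℤ * (m * b)) - -1ℤ * (1ℤ * (m * b) + -1ℤ * (m * a))
      ≡ (+ 2 * m) * b
  re≡ = solve-∀
  im≡ : ∀ m a b → 1ℤ * (1ℤ * (m * b) + -1ℤ * (m * a)) + -1ℤ * (1ℤ * (m * a) - -1ℤ * (m * b))
      ≡ (+ 2 * m) * (- a)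
  im≡ = solve-∀

-- The nested products are what the power with exponent `6 + n` unfolds to, with `z` standing for
-- the power with exponent `n`.
8∣[1±i]⁶ : ∀ s z → let sq w = 1±i s 𝔾.* (1±i s 𝔾.* w) in
  sq (sq (sq z)) ≡ + 8 · rotate s (rotate s (rotate s z))
8∣[1±i]⁶ s z = begin
  -- A scalar 1 is inserted so that `square-step` applies; it then runs through 2, 4, 8.
  sq (sq (sq z))                         ≡⟨ cong (λ w → sq (sq (sq w))) 1·z≡z ⟨
  sq (sq (sq (1ℤ · z)))                  ≡⟨ cong (λ w → sq (sq w)) (square-step s 1ℤ z) ⟩
  sq (sq (+ 2 · rotate s z))             ≡⟨ cong sq (square-step s (+ 2) (rotate s z)) ⟩
  sq (+ 4 · rotate s (rotate s z))       ≡⟨ square-step s (+ 4) (rotate s (rotate s z)) ⟩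
  + 8 · rotate s (rotate s (rotate s z)) ∎
  where
  open ≡-Reasoning
  sq : ℤ[i] → ℤ[i]
  sq w = 1±i s 𝔾.* (1±i s 𝔾.* w)
  1·z≡z : 1ℤ · z ≡ z
  1·z≡z = cong₂ _+_i (*-identityˡ (re z)) (*-identityˡ (im z))

-- For w = a + bi, N(8w - 1) = 64 N(w) - 16a + 1, which gives the quotient 4 N(w) - a.
norm[8w-1]≡1[mod16] : ∀ w {z} → z ≡ + 8 · w →
  norm (z 𝔾.+ (𝔾.- 𝔾.1#)) ≡ 1ℤ [mod + 16 ]
norm[8w-1]≡1[mod16] (a + b i) refl = divides (+ 4 * (a * a + b * b) - a) (expand a b)
  where
  expand : ∀ a b →
    ((+ 8 * a + -1ℤ) * ((+ 8 * a + -1ℤ) * 1ℤ) + (+ 8 * b + + 0) * ((+ 8 * b + + 0) * 1ℤ)) - 1ℤ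
    ≡ (+ 4 * (a * a + b * b) - a) * + 16
  expand = solve-∀

G[6+n]≡1[mod16] : ∀ s n → G s (6 ℕ.+ n) ≡ 1ℤ [mod + 16 ]
G[6+n]≡1[mod16] s n = norm[8w-1]≡1[mod16] _ {1±i s 𝔾.^ (6 ℕ.+ n)} (8∣[1±i]⁶ s (1±i s 𝔾.^ n))

lemma2p4 : (s : Sign) (p : ℕ) → GaussianMersennePrime s p →
    (x y : ℤ) → G s p ≡ x ^ 2 + + 7 * y ^ 2 →
    (x ≡ 1ℤ [mod + 8 ] ⊎ x ≡ -1ℤ [mod + 8 ]) × + 4 ∣ y
lemma2p4 s 0 (p-prime , _) = contradiction p-prime (from-no (prime? 0))
lemma2p4 s 1 (p-prime , _) = contradiction p-prime (from-no (prime? 1))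
-- Fixing the sign lets `G` evaluate to a numeral. The squares mod 7 are 0, 1, 2, 4, whereas 5 is
-- itself a non-square and 13 and 41 are both 6.
lemma2p4 Sign.+ 2 _ x y eq =
  contradiction eq (nonRepresentableMod7⇒≢form (from-yes (nonRepresentableMod7? (+ 5))) x y)
lemma2p4 Sign.- 2 _ x y eq =
  contradiction eq (nonRepresentableMod7⇒≢form (from-yes (nonRepresentableMod7? (+ 5))) x y)
lemma2p4 Sign.+ 3 _ x y eq =
  contradiction eq (nonRepresentableMod7⇒≢form (from-yes (nonRepresentableMod7? (+ 13))) x y)
lemma2p4 Sign.- 3 _ x y eq =
  contradiction eq (nonRepresentableMod7⇒≢form (from-yes (nonRepresentableMod7? (+ 13))) x y)
lemma2p4 s 4 (p-prime , _) = contradiction p-prime (from-no (prime? 4))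
lemma2p4 Sign.+ 5 _ x y eq =
  contradiction eq (nonRepresentableMod7⇒≢form (from-yes (nonRepresentableMod7? (+ 41))) x y)
lemma2p4 Sign.- 5 _ x y eq =
  contradiction eq (nonRepresentableMod7⇒≢form (from-yes (nonRepresentableMod7? (+ 41))) x y)
lemma2p4 s (suc (suc (suc (suc (suc (suc n)))))) _ x y eq =
  form≡1[mod16] x y (subst (λ g → g ≡ 1ℤ [mod + 16 ]) eq (G[6+n]≡1[mod16] s n))
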